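{- Let $k>1$ and $\ell\leq k$ be integers. Assume that for any integer $s>0$ there is a $k$-tree such that for every $\ell$-local queue layout of it, there is a $k$-clique with at least $s$ non-nesting children. Then there is a $k$-tree with local queue number at least $\ell+1$.
   Context: Graphs are finite, simple and undirected. Given a linear ordering $\prec$ of the vertex set, two edges $uv$ and $xy$ nest if $u \prec x \prec y \prec v$ or $x \prec u \prec v \prec y$ (for the endpoints named suitably). A queue is a set of edges no two of which nest. A queue layout of $G$ consists of a linear ordering $\prec$ of $V(G)$ and a partition of $E(G)$ into queues; it is $\ell$-local if every vertex has incident edges in at most $\ell$ queues (the number of queues being arbitrary). The local queue number of $G$ is the smallest $\ell$ such that $G$ has an $\ell$-local queue layout. A $k$-tree is a $(k+1)$-clique or is obtained from a smaller $k$-tree by choosing a clique $C$ of size $k$ and adding a new vertex $u$ adjacent to exactly the vertices of $C$. Fixing a construction ordering of the $k$-tree, $u$ is called a child of $C$ and $C$ the parent clique of $u$. With respect to a vertex ordering $\prec$, a child $u$ of $C$ is nesting if it is placed below its parent clique, i.e. if $c\prec u\prec c'$ for some $c,c'\in C$, and non-nesting otherwise, i.e. if $u$ lies to the left or to the right of all vertices of $C$. Each $k$-tree in the hypothesis comes with a fixed construction ordering. -}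

module Defs where

open import Data.Empty using (⊥)
open import Data.Fin using (Fin; zero; suc)
open import Data.Fin.Properties using (_≟_; any?)
open import Data.Fin.Subset using (Subset; outside; _∈_; ∣_∣)
open import Data.Fin.Subset.Properties using (_∈?_)
open import Data.Nat using (ℕ; suc; _≤_)
open import Data.Product using (_×_; ∃-syntax; Σ-syntax)
open import Data.Sum using (_⊎_)
open import Data.Vec using (_∷_; tabulate)
open import Level using (0ℓ)
open import Relation.Binary.Core using (Rel)
open import Relation.Binary.Definitions using (Decidable; Irreflexive; Symmetric)
open import Relation.Binary.PropositionalEquality using (_≡_; _≢_; refl; sym)
open import Relation.Binary.Structures using (IsStrictTotalOrder)
open import Relation.Nullary using (¬_; no; does; ¬?; _×-dec_)

record Graph (n : ℕ) : Set₁ where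
  field
    Adj        : Rel (Fin n) 0ℓ
    adj?       : Decidable Adj
    adj-sym    : Symmetric Adj
    adj-irrefl : Irreflexive _≡_ Adj

open Graph public

IsClique : ∀ {n} → Graph n → Subset n → Set
IsClique G C = ∀ u v → u ∈ C → v ∈ C → u ≢ v → Adj G u v

complete : ∀ n → Graph n
complete n = record
  { Adj        = _≢_
  ; adj?       = λ u v → ¬? (u ≟ v)
  ; adj-sym    = λ u≢v v≡u → u≢v (sym v≡u)
  ; adj-irrefl = λ u≡v u≢v → u≢v u≡v
  }

-- The new vertex is zero; an old vertex v is renamed to suc v.
attach : ∀ {n} → Graph n → Subset n → Graph (suc n)
attach {n} G C = record
  { Adj        = A
  ; adj?       = A?
  ; adj-sym    = λ {u} {v} → A-sym u v
  ; adj-irrefl = λ {u} {v} → A-irrefl u v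
  }
  where
  A : Rel (Fin (suc n)) 0ℓ
  A zero    zero    = ⊥
  A zero    (suc v) = v ∈ C
  A (suc u) zero    = u ∈ C
  A (suc u) (suc v) = Adj G u v

  A? : Decidable A
  A? zero    zero    = no λ ()
  A? zero    (suc v) = v ∈? C
  A? (suc u) zero    = u ∈? C
  A? (suc u) (suc v) = adj? G u v

  A-sym : ∀ u v → A u v → A v u
  A-sym zero    (suc v) a = a
  A-sym (suc u) zero    a = a
  A-sym (suc u) (suc v) a = adj-sym G a

  A-irrefl : ∀ u v → u ≡ v → ¬ A u v
  A-irrefl zero    .zero    refl ()
  A-irrefl (suc u) .(suc u) refl a = adj-irrefl G refl a

-- A k-tree together with a fixed construction ordering.
mutual
  data KTree (k : ℕ) : ℕ → Set where
    base   : KTree k (suc k)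
    extend : ∀ {n} (T : KTree k n) (C : Subset n) →
             IsClique (graph T) C → ∣ C ∣ ≡ k → KTree k (suc n)

  graph : ∀ {k n} → KTree k n → Graph n
  graph {k} base         = complete (suc k)
  graph (extend T C _ _) = attach (graph T) C

-- Child T u C: the vertex u was added with parent clique C.  The vertices of
-- the initial (k+1)-clique are not children.
data Child {k : ℕ} : ∀ {n} → KTree k n → Fin n → Subset n → Set where
  new : ∀ {n} {T : KTree k n} {C : Subset n}
        {C-clique : IsClique (graph T) C} {C-size : ∣ C ∣ ≡ k} →
        Child (extend T C C-clique C-size) zero (outside ∷ C)
  old : ∀ {n} {T : KTree k n} {D : Subset n}
        {D-clique : IsClique (graph T) D} {D-size : ∣ D ∣ ≡ k}
        {u : Fin n} {C : Subset n} → Child T u C →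
        Child (extend T D D-clique D-size) (suc u) (outside ∷ C)

module _ {n : ℕ} (_≺_ : Rel (Fin n) 0ℓ) where

  Nest : (u v x y : Fin n) → Set
  Nest u v x y = (u ≺ x × x ≺ y × y ≺ v) ⊎ (x ≺ u × u ≺ v × v ≺ y)

  -- A set of edges is a symmetric relation, so quantifying over all ordered
  -- pairs covers every naming of the endpoints.
  IsQueue : Rel (Fin n) 0ℓ → Set
  IsQueue Q = ∀ {u v x y} → Q u v → Q x y → ¬ Nest u v x y

  NestingChild : Fin n → Subset n → Set
  NestingChild u C = ∃[ c ] ∃[ c′ ] c ∈ C × c′ ∈ C × c ≺ u × u ≺ c′

  NonNestingChild : Fin n → Subset n → Set
  NonNestingChild u C = ¬ NestingChild u C

-- The partition of the edges is given by the map queueOf; its values on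
-- non-adjacent pairs are irrelevant.
record QueueLayout {n : ℕ} (G : Graph n) : Set₁ where
  field
    _≺_         : Rel (Fin n) 0ℓ
    ≺-isSTO     : IsStrictTotalOrder _≡_ _≺_
    #queues     : ℕ
    queueOf     : Fin n → Fin n → Fin #queues
    queueOf-sym : ∀ {u v} → Adj G u v → queueOf u v ≡ queueOf v u

  Queue : Fin #queues → Rel (Fin n) 0ℓ
  Queue i u v = Adj G u v × queueOf u v ≡ i

  field
    isQueue : ∀ i → IsQueue _≺_ (Queue i)

  queuesAt : Fin n → Subset #queues
  queuesAt u = tabulate λ i → does (any? λ v → adj? G u v ×-dec (queueOf u v ≟ i))

IsLocal : ∀ {n} {G : Graph n} → ℕ → QueueLayout G → Set
IsLocal ℓ L = ∀ u → ∣ QueueLayout.queuesAt L u ∣ ≤ ℓ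

HasLocalLayout : ∀ {n} → Graph n → ℕ → Set₁
HasLocalLayout G ℓ = Σ[ L ∈ QueueLayout G ] IsLocal ℓ L

IsLocalQueueNumber : ∀ {n} → Graph n → ℕ → Set₁
IsLocalQueueNumber G q =
  HasLocalLayout G q × (∀ m → HasLocalLayout G m → q ≤ m)

ManyNonNestingChildren : ∀ {k n} (T : KTree k n) → QueueLayout (graph T) → ℕ → Set
ManyNonNestingChildren {k} {n} T L s =
  Σ[ C ∈ Subset n ] IsClique (graph T) C × ∣ C ∣ ≡ k ×
  Σ[ S ∈ Subset n ] s ≤ ∣ S ∣ ×
    (∀ {u} → u ∈ S → Child T u C × NonNestingChild (QueueLayout._≺_ L) u C)

{-# OPTIONS --safe #-}
-- Let C be a clique with many children to its right (otherwise reverse the order) in an ℓ-local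
-- layout, ℓ ≤ k.  Among children with the same colour (queue) on each edge to C, these k colours
-- are distinct, so a child u between two others sees no further colour, and every other neighbour
-- of u lies to the right of all these siblings, since otherwise its edge to u nests with an edge
-- from C to a sibling.
--
-- Give every k-clique many new children and repeat k + 1 times.  Fixing u and all but two vertices
-- of C, one finds a chain v₀ = c₁, v₁, …, vₖ₊₁, where vₙ₊₁ is such a middle child of
-- {u, vₙ} ∪ (C ∖ {c₀, c₁}).  Only the colours seen by C occur, so two children u ≺ u′ have chains
-- v, v′ with the same colours.  Then v′ₙ ≺ vₙ₊₁ for all n, by induction: otherwise v′ₙ and the copy
-- of the parent of vₙ whose edge has the colour of vₙvₙ₊₁ cover that edge.  Two of the k + 1
-- edges uvₙ have the same colour, say those to vₘ and vₙ with m < n; so u′v′ₘ has the colour of uvₙ,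
-- and u ≺ u′ ≺ v′ₘ ≺ vₙ is a nesting.
--
-- The exact local queue number exists because having an m-local layout is decidable.
module Submission where

open import Defs
open import Data.Bool using (Bool; true; false)
open import Data.Bool.Properties using () renaming (_≟_ to _≟ᵇ_)
open import Data.Empty using (⊥; ⊥-elim)
open import Data.Fin using (Fin; zero; suc; toℕ; fromℕ<; combine; remQuot) renaming (_<_ to _<ᶠ_)
open import Data.Fin.Properties using (all?; any?; suc-injective; pigeonhole; remQuot-combine;
  toℕ<n; toℕ-fromℕ<; injective⇒≤)
import Data.Fin.Properties as Fin
open import Data.Fin.Subset using (Subset; inside; outside; ∣_∣) renaming (_∈_ to _∈ˢ_; ⊥ to ∅)
open import Data.Fin.Subset.Properties using (∣⊥∣≡0; ∉⊥; ∣p∣≤n; p⊆q⇒∣p∣≤∣q∣)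
open import Data.List using (List; []; _∷_; _++_; length; filter; cartesianProductWith)
import Data.List as List
open import Data.List.Membership.Propositional using (_∈_)
open import Data.List.Membership.Propositional.Properties using (∈-filter⁻; ∈-map⁺; ∈-map⁻;
  ∈-tabulate⁻; ∈-lookup; ∈-allFin; ∈-++⁺ˡ; ∈-++⁺ʳ; ∈-cartesianProductWith⁺)
open import Data.List.Properties using (length-map; length-tabulate; length-++)
open import Data.List.Relation.Binary.Permutation.Propositional
  using (_↭_; prep; swap; ↭-refl; ↭-sym; ↭-trans; ↭⇒↭ₛ)
open import Data.List.Relation.Binary.Permutation.Propositional.Properties using (↭-length; ∈-resp-↭)
import Data.List.Relation.Binary.Permutation.Setoid.Properties as Permutationₛ
open import Data.List.Relation.Binary.Subset.Propositional using (_⊆_)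
open import Data.List.Relation.Unary.All using (All; []; _∷_)
import Data.List.Relation.Unary.All as All
import Data.List.Relation.Unary.All.Properties as All
open import Data.List.Relation.Unary.AllPairs using ([]; _∷_)
open import Data.List.Relation.Unary.Any using (here; there; index)
open import Data.List.Relation.Unary.Any.Properties using (lookup-index)
open import Data.List.Relation.Unary.Unique.Propositional using (Unique)
import Data.List.Relation.Unary.Unique.Propositional.Properties as Unique
open import Data.Nat using (ℕ; zero; suc; _+_; _*_; _^_; _≤_; _<_; _≤?_; z≤n; s≤s; s≤s⁻¹)
import Data.Nat as ℕ
open import Data.Nat.Properties using (≤-refl; ≤-reflexive; ≤-trans; ≤-<-trans; <-≤-trans; <⇒≤; <⇒≢; <⇒≱;
  ≮⇒≥; ≰⇒>; n<1+n; m≤n⇒m<n∨m≡n; m+n≤o⇒m≤o; +-comm; +-suc; +-cancelˡ-≡; +-cancelˡ-<; +-mono-≤; +-monoˡ-≤;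
  *-assoc; *-identityˡ; *-monoˡ-≤; ^-monoˡ-≤; module ≤-Reasoning)
open import Data.Product using (_×_; _,_; proj₁; proj₂; ∃; ∃₂; ∃-syntax; Σ-syntax)
open import Data.Sum using (_⊎_; inj₁; inj₂)
open import Data.Unit using (⊤; tt)
open import Data.Vec using (Vec; []; _∷_; lookup; map; tabulate; _[_]≔_; here; there)
open import Data.Vec.Properties using (lookup-map; map-∘; map-[]≔; lookup∘tabulate; lookup∘update;
  lookup∘update′; []=⇒lookup; lookup⇒[]=)
open import Function using (_∘_; id; flip)
open import Function.Definitions using (Injective)
open import Level using (0ℓ)
import Relation.Binary.Construct.Flip.EqAndOrd as Flip
open import Relation.Binary.Core using (Rel)
open import Relation.Binary.Definitions using (DecidableEquality; Tri; tri<; tri≈; tri>)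
open import Relation.Binary.PropositionalEquality
open import Relation.Binary.Structures using (IsStrictTotalOrder)
open import Relation.Binary.Structures.Biased using (isStrictTotalOrderᶜ)
open import Relation.Nullary using (¬_; Dec; yes; no; ¬?; does; contradiction; _×-dec_; _⊎-dec_)
open import Relation.Nullary.Decidable using (_→-dec_; map′; dec-true)
open import Relation.Unary using (Pred; Decidable)

-- Pigeonhole principles for lists of colours.

length-filter-¬ : ∀ {A : Set} {P : Pred A 0ℓ} (P? : Decidable P) xs →
  length (filter P? xs) + length (filter (¬? ∘ P?) xs) ≡ length xs
length-filter-¬ P? []       = refl
length-filter-¬ P? (x ∷ xs) with P? x
... | yes _ = cong suc (length-filter-¬ P? xs)
... | no  _ = trans (+-suc _ _) (cong suc (length-filter-¬ P? xs))

module _ {X Color : Set} (_≟_ : DecidableEquality Color) where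

  -- Induction on `L`: either its first colour is taken more than `m` times, or discarding the at
  -- most `m` elements that take it leaves enough elements for the other colours.
  popular-value : ∀ (L : List Color) m (g : X → Color) (xs : List X) → Unique xs →
    (∀ {x} → x ∈ xs → g x ∈ L) → length L * m < length xs →
    Σ[ ys ∈ List X ] ys ⊆ xs × Unique ys × m < length ys ×
      (∀ {x y} → x ∈ ys → y ∈ ys → g x ≡ g y)
  popular-value []      m g (x ∷ xs) xs! g∈ _ with () ← g∈ (here refl)
  popular-value (c ∷ L) m g xs xs! g∈ <xs with m ℕ.<? length (filter (λ x → g x ≟ c) xs)
  ... | yes m<ys =
    filter c? xs , proj₁ ∘ ∈-filter⁻ c? , Unique.filter⁺ c? xs! , m<ys ,
    λ x∈ y∈ → trans (proj₂ (∈-filter⁻ c? {xs = xs} x∈)) (sym (proj₂ (∈-filter⁻ c? {xs = xs} y∈)))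
    where
    c? : Decidable (λ x → g x ≡ c)
    c? x = g x ≟ c
  ... | no m≮ys =
    let ys , ys⊆ , ys! , m<ys , const =
          popular-value L m g zs (Unique.filter⁺ ¬c? xs!) g∈L
            (+-cancelˡ-< m _ _ (<-≤-trans <xs (begin
              length xs                             ≡⟨ length-filter-¬ c? xs ⟨
              length (filter c? xs) + length zs     ≤⟨ +-monoˡ-≤ (length zs) (≮⇒≥ m≮ys) ⟩
              m + length zs                         ∎)))
    in ys , (proj₁ ∘ ∈-filter⁻ ¬c?) ∘ ys⊆ , ys! , m<ys , const
    where
    open ≤-Reasoning
    c? : Decidable (λ x → g x ≡ c)
    c? x = g x ≟ c
    ¬c? : Decidable (λ x → ¬ g x ≡ c)
    ¬c? = ¬? ∘ c?
    zs : List X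
    zs = filter ¬c? xs
    g∈L : ∀ {x} → x ∈ zs → g x ∈ L
    g∈L x∈ with ∈-filter⁻ ¬c? {xs = xs} x∈
    ... | x∈xs , gx≢c with g∈ x∈xs
    ...   | here gx≡c = contradiction gx≡c gx≢c
    ...   | there gx∈ = gx∈

  -- The coordinates are made constant one at a time, each costing a factor `length L`. This serves
  -- twice: for the edges from a child to its clique, and for the colours of a whole chain.
  popular-pattern : ∀ (L : List Color) p m (f : X → Fin p → Color) (xs : List X) → Unique xs →
    (∀ {x} → x ∈ xs → ∀ i → f x i ∈ L) → length L ^ p * m < length xs →
    Σ[ ys ∈ List X ] ys ⊆ xs × Unique ys × m < length ys ×
      (∀ {x y} → x ∈ ys → y ∈ ys → ∀ i → f x i ≡ f y i)
  popular-pattern L zero    m f xs xs! f∈ m<xs =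
    xs , id , xs! , subst (_< length xs) (*-identityˡ m) m<xs , λ _ _ ()
  popular-pattern L (suc p) m f xs xs! f∈ <xs =
    let ys , ys⊆ , ys! , <ys , const₀ =
          popular-value L (length L ^ p * m) (λ x → f x zero) xs xs! (λ x∈ → f∈ x∈ zero)
            (subst (_< length xs) (*-assoc (length L) (length L ^ p) m) <xs)
        zs , zs⊆ , zs! , m<zs , const =
          popular-pattern L p m (λ x → f x ∘ suc) ys ys! (λ x∈ → f∈ (ys⊆ x∈) ∘ suc) <ys
    in zs , ys⊆ ∘ zs⊆ , zs! , m<zs ,
       λ { x∈ y∈ zero → const₀ (zs⊆ x∈) (zs⊆ y∈) ; x∈ y∈ (suc i) → const x∈ y∈ i }

-- The entry `y` and the `k` values of `q` have positions in a list of length at most `k`, so two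
-- positions agree; since `q` is injective, one of them is that of `y`.
exhausted : ∀ {A : Set} {k} (q : Fin k → A) (L : List A) → length L ≤ k →
  (∀ {a b} → q a ≡ q b → a ≡ b) → (∀ a → q a ∈ L) → ∀ {y} → y ∈ L → ∃[ a ] y ≡ q a
exhausted {k = k} q L L≤k q-inj q∈ {y} y∈ with pigeonhole (s≤s L≤k) position
  where
  position : Fin (suc k) → Fin (length L)
  position zero    = index y∈
  position (suc a) = index (q∈ a)
... | zero  , suc b , _ , eq =
  b , trans (lookup-index y∈) (trans (cong (List.lookup L) eq) (sym (lookup-index (q∈ b))))
... | suc a , suc b , s≤s a<b , eq = contradiction (cong toℕ (q-inj
    (trans (lookup-index (q∈ a)) (trans (cong (List.lookup L) eq) (sym (lookup-index (q∈ b)))))))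
    (<⇒≢ a<b)

-- Leftmost and rightmost elements.

Unique-resp-↭ : ∀ {A : Set} {xs ys : List A} → xs ↭ ys → Unique xs → Unique ys
Unique-resp-↭ perm = Permutationₛ.Unique-resp-↭ (setoid _) (↭⇒↭ₛ perm)

module _ {V : Set} {_≺_ : Rel V 0ℓ} (sto : IsStrictTotalOrder _≡_ _≺_) where
  open IsStrictTotalOrder sto using (compare) renaming (trans to ≺-trans)

  minimum : ∀ x (xs : List V) → Unique (x ∷ xs) →
    ∃₂ λ lo ys → (x ∷ xs) ↭ (lo ∷ ys) × All (lo ≺_) ys
  minimum x []        _            = x , [] , ↭-refl , []
  minimum x (x′ ∷ xs) (x∉ ∷ xs!) with minimum x′ xs xs!
  ... | lo , ys , perm , lo≺ with compare x lo
  ...   | tri< x≺lo _ _ = x , lo ∷ ys , prep x perm , x≺lo ∷ All.map (≺-trans x≺lo) lo≺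
  ...   | tri≈ _ x≡lo _ = contradiction x≡lo (All.lookup x∉ (∈-resp-↭ (↭-sym perm) (here refl)))
  ...   | tri> _ _ lo≺x = lo , x ∷ ys , ↭-trans (prep x perm) (swap x lo ↭-refl) , lo≺x ∷ lo≺

-- The rightmost element is the minimum of the remaining list in the reversed order. Removing two
-- elements accounts for the drop from `suc m <` to `m ≤`.
extremes : ∀ {V : Set} {_≺_ : Rel V 0ℓ} → IsStrictTotalOrder _≡_ _≺_ →
  ∀ m (xs : List V) → Unique xs → suc m < length xs →
  ∃₂ λ lo hi → Σ[ ys ∈ List V ] lo ∈ xs × hi ∈ xs × ys ⊆ xs × Unique ys × m ≤ length ys ×
    (∀ {y} → y ∈ ys → lo ≺ y × y ≺ hi)
extremes sto m (x ∷ xs) xs! m<xs with minimum sto x xs xs!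
... | lo , [] , perm , _ with s≤s () ← subst (suc m <_) (↭-length perm) m<xs
... | lo , y ∷ ys , perm , lo≺
  with _ ∷ ys! ← Unique-resp-↭ perm xs!
  with minimum (Flip.isStrictTotalOrder sto) y ys ys!
... | hi , zs , perm′ , ≺hi =
  lo , hi , zs , back (here refl) , back (there (∈-resp-↭ (↭-sym perm′) (here refl))) ,
  (λ z∈ → back (there (∈-resp-↭ (↭-sym perm′) (there z∈)))) ,
  zs! ,
  s≤s⁻¹ (s≤s⁻¹ (subst (suc m <_) (trans (↭-length perm) (cong suc (↭-length perm′))) m<xs)) ,
  λ z∈ → All.lookup lo≺ (∈-resp-↭ (↭-sym perm′) (there z∈)) , All.lookup ≺hi z∈
  where
  back : ∀ {v} → v ∈ lo ∷ y ∷ ys → v ∈ x ∷ xs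
  back = ∈-resp-↭ (↭-sym perm)
  zs! : Unique zs
  zs! with _ ∷ zs! ← Unique-resp-↭ perm′ ys! = zs!

-- Rich cliques and layouts with bounded palettes.

module _ {V : Set} (Adj : Rel V 0ℓ) where

  -- Cliques are vectors so that a child can overwrite a given position and colours of edges to a
  -- clique can be compared position by position.
  Clique : ∀ {k} → Vec V k → Set
  Clique D = ∀ {a b} → a ≢ b → Adj (lookup D a) (lookup D b)

  Joined : ∀ {k} → Vec V k → V → Set
  Joined D w = ∀ a → Adj (lookup D a) w

  -- Children added while d further rounds remain have level d; distinct rounds thus give distinct
  -- vertices.
  Rich : (level : V → ℕ) (N : ℕ) → ℕ → ∀ {k} → Vec V k → Set
  Rich level N zero    D = ⊤
  Rich level N (suc d) D = Clique D ×
    (Σ[ w ∈ (Fin N → V) ] Injective _≡_ _≡_ w ×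
      (∀ i → Joined D (w i) × level (w i) ≡ d × (∀ a → Rich level N d (D [ a ]≔ w i))))

  record LocalLayout (k : ℕ) : Set₁ where
    field
      {Color}        : Set
      _≟_            : DecidableEquality Color
      color          : V → V → Color
      color-sym      : ∀ {u v} → Adj u v → color u v ≡ color v u
      palette        : V → List Color
      palette-length : ∀ v → length (palette v) ≤ k
      color∈palette  : ∀ {u v} → Adj u v → color u v ∈ palette u
      _≺_            : Rel V 0ℓ
      ≺-isSTO        : IsStrictTotalOrder _≡_ _≺_
      noNest         : ∀ {u v x y} → Adj u v → Adj x y → color u v ≡ color x y →
                       u ≺ x → x ≺ y → y ≺ v → ⊥

-- Children between two siblings.

module _ {V : Set} {Adj : Rel V 0ℓ}
  (Adj-sym : ∀ {u v} → Adj u v → Adj v u) (Adj-irrefl : ∀ {v} → ¬ Adj v v) where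

  reverse : ∀ {k} → LocalLayout Adj k → LocalLayout Adj k
  reverse Λ = record
    { _≟_ = _≟_ ; color = color ; color-sym = color-sym
    ; palette = palette ; palette-length = palette-length ; color∈palette = color∈palette
    ; _≺_ = flip _≺_ ; ≺-isSTO = Flip.isStrictTotalOrder ≺-isSTO
    -- Read in the original order, the edge `vu` covers `yx`; both edges change direction, hence the
    -- symmetry of adjacency and of colours.
    ; noNest = λ uv xy same u≻x x≻y y≻v → noNest (Adj-sym uv) (Adj-sym xy)
        (trans (sym (color-sym uv)) (trans same (color-sym xy))) y≻v x≻y u≻x
    }
    where open LocalLayout Λ

  module _ {k} (Λ : LocalLayout Adj k) where
    open LocalLayout Λ
    open IsStrictTotalOrder ≺-isSTO using (compare) renaming (trans to ≺-trans)

    ≺-⊁-trans : ∀ {x y z} → x ≺ y → ¬ (z ≺ y) → x ≺ z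
    ≺-⊁-trans {y = y} {z} x≺y z⊀y with compare y z
    ... | tri< y≺z _ _  = ≺-trans x≺y y≺z
    ... | tri≈ _ refl _ = x≺y
    ... | tri> _ _ z≺y  = contradiction z≺y z⊀y

    -- A child w of D with a sibling on either side, the right one being hi.
    record Middle (hi : V) (D : Vec V k) (w : V) : Set where
      field
        joined    : Joined Adj D w
        right     : ∀ a → lookup D a ≺ w
        below     : w ≺ hi
        beyond    : ∀ {x} → Adj w x → (∀ a → lookup D a ≢ x) → ¬ (x ≺ hi)
        saturated : ∀ {x} → Adj w x → ∃[ a ] color w x ≡ color (lookup D a) w

    -- The `k` edges from `D` to `w` have pairwise distinct colours and therefore use up the palette
    -- of `w`. Each further edge at `w` repeats one of these colours, which restricts where it can
    -- end.
    between⇒middle : ∀ {lo w hi} (D : Vec V k) → Clique Adj D →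
      Joined Adj D lo → Joined Adj D w → Joined Adj D hi →
      (∀ a → lookup D a ≺ lo) → lo ≺ w → w ≺ hi →
      (∀ a → color (lookup D a) w ≡ color (lookup D a) lo) →
      (∀ a → color (lookup D a) hi ≡ color (lookup D a) w) →
      Middle hi D w
    between⇒middle {lo} {w} {hi} D D-clique D-lo D-w D-hi D≺lo lo≺w w≺hi same-lo same-hi = record
      { joined = D-w ; right = D≺w ; below = w≺hi ; beyond = beyond ; saturated = saturated }
      where
      D≺w : ∀ a → lookup D a ≺ w
      D≺w a = ≺-trans (D≺lo a) lo≺w

      -- If two colours agree, the edge to `w` from the left one of the two clique vertices covers
      -- the edge from the other one to `lo`.
      distinct : ∀ {a b} → a ≢ b → color (lookup D a) w ≢ color (lookup D b) w
      distinct {a} {b} a≢b same with compare (lookup D a) (lookup D b)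
      ... | tri< a≺b _ _ = noNest (D-w a) (D-lo b) (trans same (same-lo b)) a≺b (D≺lo b) lo≺w
      ... | tri≈ _ a≡b _ = Adj-irrefl (subst (Adj (lookup D a)) (sym a≡b) (D-clique a≢b))
      ... | tri> _ _ b≺a = noNest (D-w b) (D-lo a) (trans (sym same) (same-lo a)) b≺a (D≺lo a) lo≺w

      injective : ∀ {a b} → color (lookup D a) w ≡ color (lookup D b) w → a ≡ b
      injective {a} {b} same with a Fin.≟ b
      ... | yes a≡b = a≡b
      ... | no  a≢b = contradiction same (distinct a≢b)

      saturated : ∀ {x} → Adj w x → ∃[ a ] color w x ≡ color (lookup D a) w
      saturated w-x = exhausted (λ a → color (lookup D a) w) (palette w) (palette-length w)
        injective
        (λ a → subst (_∈ palette w) (sym (color-sym (D-w a))) (color∈palette (Adj-sym (D-w a))))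
        (color∈palette w-x)

      -- Let `a` be the position whose colour `wx` repeats. If `x` lies left of `hi` but right of
      -- that clique vertex, the edge from there to `hi` covers `wx`; if `x` lies left of it, `wx`
      -- covers the edge from there to `lo`.
      beyond : ∀ {x} → Adj w x → (∀ a → lookup D a ≢ x) → ¬ (x ≺ hi)
      beyond {x} w-x x∉D x≺hi with saturated w-x
      ... | a , same with compare x w
      ...   | tri≈ _ refl _ = Adj-irrefl w-x
      ...   | tri> _ _ w≺x  = noNest (D-hi a) w-x (trans (same-hi a) (sym same)) (D≺w a) w≺x x≺hi
      ...   | tri< x≺w _ _ with compare (lookup D a) x
      ...     | tri< a≺x _ _ = noNest (D-hi a) (Adj-sym w-x)
                (trans (same-hi a) (trans (sym same) (color-sym w-x))) a≺x x≺w w≺hi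
      ...     | tri≈ _ a≡x _ = x∉D a a≡x
      ...     | tri> _ _ x≺a = noNest (Adj-sym w-x) (D-lo a)
                (trans (sym (color-sym w-x)) (trans same (same-lo a))) x≺a (D≺lo a) lo≺w

    -- Among children with the same colours towards `D`, all but the leftmost and the rightmost are
    -- middle, with a common `hi`. The bound `B` replaces `length L` so that the number of children
    -- can be fixed before a layout is given.
    middles : ∀ {B} (L : List Color) → length L ≤ B → ∀ m (D : Vec V k) → Clique Adj D →
      (ws : List V) → Unique ws →
      (∀ {w} → w ∈ ws → Joined Adj D w × (∀ a → lookup D a ≺ w) × (∀ a → color (lookup D a) w ∈ L)) →
      B ^ k * suc m < length ws →
      ∃[ hi ] Σ[ ys ∈ List V ] ys ⊆ ws × Unique ys × m ≤ length ys ×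
        (∀ {y} → y ∈ ys → Middle hi D y)
    middles {B} L L≤B m D D-clique ws ws! children <ws
      with popular-pattern _≟_ L k (suc m) (λ w a → color (lookup D a) w) ws ws!
             (λ w∈ → proj₂ (proj₂ (children w∈)))
             (≤-<-trans (*-monoˡ-≤ (suc m) (^-monoˡ-≤ k L≤B)) <ws)
    ... | zs , zs⊆ , zs! , m<zs , const with extremes ≺-isSTO m zs zs! m<zs
    ... | lo , hi , ys , lo∈ , hi∈ , ys⊆ , ys! , m≤ys , between =
      hi , ys , zs⊆ ∘ ys⊆ , ys! , m≤ys , λ y∈ →
        between⇒middle D D-clique (join lo∈) (join (ys⊆ y∈)) (join hi∈)
          (proj₁ (proj₂ (children (zs⊆ lo∈)))) (proj₁ (between y∈)) (proj₂ (between y∈))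
          (const (ys⊆ y∈) lo∈) (const hi∈ (ys⊆ y∈))
      where
      join : ∀ {w} → w ∈ zs → Joined Adj D w
      join w∈ = proj₁ (children (zs⊆ w∈))

  -- Chains of middle children.

  module _ {j : ℕ} (Λ : LocalLayout Adj (2 + j)) (level : V → ℕ) (N : ℕ)
    (B : ℕ) (L : List (LocalLayout.Color Λ)) (L≤B : length L ≤ B) (<N : B ^ (2 + j) * 2 < N)
    (c₁ : V) (cs : Vec V j) where
    open LocalLayout Λ
    open IsStrictTotalOrder ≺-isSTO using (compare) renaming (trans to ≺-trans)

    -- By `level-≡` the levels drop by one along the chain, so vertices at different positive
    -- positions differ even between two chains of the same length. By `color∈` all colours come
    -- from `L`, so there are boundedly many colour patterns.
    record Chain (u v : V) (d : ℕ) : Set where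
      field
        vertex  : ℕ → V
        start   : vertex 0 ≡ v
        middle  : ∀ {n} → n < d → ∃[ hi ] Middle Λ hi (u ∷ vertex n ∷ cs) (vertex (suc n))
        color∈  : ∀ {n} → n < d → ∀ a →
                  color (lookup (u ∷ vertex n ∷ cs) a) (vertex (suc n)) ∈ L
        level-≡ : ∀ {n} → n < d → level (vertex (suc n)) + suc n ≡ d

    module _ {u hi : V} (K : ℕ) (u≺hi : u ≺ hi) (cs≺u : ∀ a → lookup cs a ≺ u)
      (u-beyond : ∀ {x} → Adj u x → level x < K → ¬ (x ≺ hi) × color u x ∈ L)
      (cs-color : ∀ a {x} → Adj (lookup cs a) x → color (lookup cs a) x ∈ L) where

      -- Induction on the remaining rounds. The vertices of the current clique have level at least
      -- `d` and those still to come have smaller level, so the latter lie outside the clique. The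
      -- last hypothesis is the invariant: common neighbours of `u` and `v` still to come lie to the
      -- right of `v`, and their edges to `v` have colours in `L`.
      chain : ∀ d v → d ≤ K → Rich Adj level N d (u ∷ v ∷ cs) →
        (∀ a → d ≤ level (lookup (u ∷ v ∷ cs) a)) →
        (∀ {x} → Adj v x → Adj u x → level x < d → v ≺ x × color v x ∈ L) → Chain u v d
      chain zero    v _   _ _ _ = record
        { vertex = λ _ → v ; start = refl ; middle = λ () ; color∈ = λ () ; level-≡ = λ () }
      chain (suc d) v d<K (clique , w , w-inj , w-child) D-old v-beyond
        -- A single middle child continues the chain, whence the bound `B ^ (2 + j) * 2` for `N`.
        with middles Λ L L≤B 1 (u ∷ v ∷ cs) clique (List.tabulate w) (Unique.tabulate⁺ w-inj) fits
               (subst (B ^ (2 + j) * 2 <_) (sym (length-tabulate w)) <N)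
        where
        fits : ∀ {x} → x ∈ List.tabulate w → Joined Adj (u ∷ v ∷ cs) x ×
          (∀ a → lookup (u ∷ v ∷ cs) a ≺ x) × (∀ a → color (lookup (u ∷ v ∷ cs) a) x ∈ L)
        fits x∈ with ∈-tabulate⁻ x∈
        ... | i , refl with w-child i
        ... | D-x , level-x , _ = D-x , D≺x , D-color
          where
          fresh : level (w i) < suc d
          fresh = ≤-reflexive (cong suc level-x)
          u-x = u-beyond (D-x zero) (≤-trans fresh d<K)
          u≺x : u ≺ w i
          u≺x = ≺-⊁-trans Λ u≺hi (proj₁ u-x)
          v-x = v-beyond (D-x (suc zero)) (D-x zero) fresh
          D≺x : ∀ a → lookup (u ∷ v ∷ cs) a ≺ w i
          D≺x zero          = u≺x
          D≺x (suc zero)    = proj₁ v-x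
          D≺x (suc (suc a)) = ≺-trans (cs≺u a) u≺x
          D-color : ∀ a → color (lookup (u ∷ v ∷ cs) a) (w i) ∈ L
          D-color zero          = proj₂ u-x
          D-color (suc zero)    = proj₂ v-x
          D-color (suc (suc a)) = cs-color a (D-x (suc (suc a)))
      ... | hi′ , y ∷ _ , ys⊆ , _ , _ , y-middle with ∈-tabulate⁻ (ys⊆ (here refl))
      ... | i , refl = record
        { vertex  = λ { zero → v ; (suc n) → vertex n }
        ; start   = refl
        ; middle  = λ { {zero} _ → hi′ , subst (Middle Λ hi′ (u ∷ v ∷ cs)) (sym start) mid
                      ; {suc n} (s≤s n<d) → middle n<d }
        ; color∈  = λ { {zero} _ → subst (λ x → ∀ a → color (lookup (u ∷ v ∷ cs) a) x ∈ L)
                                     (sym start) w-color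
                      ; {suc n} (s≤s n<d) → color∈ n<d }
        ; level-≡ = λ { {zero} _ → trans (+-comm _ 1)
                                     (cong suc (trans (cong level start) level-w))
                      ; {suc n} (s≤s n<d) → trans (+-suc _ _) (cong suc (level-≡ n<d)) }
        }
        where
        mid : Middle Λ hi′ (u ∷ v ∷ cs) (w i)
        mid = y-middle (here refl)
        open Middle mid
        level-w : level (w i) ≡ d
        level-w = proj₁ (proj₂ (w-child i))
        w-color : ∀ a → color (lookup (u ∷ v ∷ cs) a) (w i) ∈ L
        w-color zero          =
          proj₂ (u-beyond (joined zero) (≤-trans (≤-reflexive (cong suc level-w)) d<K))
        w-color (suc zero)    = proj₂ (v-beyond (joined (suc zero)) (joined zero)
          (≤-reflexive (cong suc level-w)))
        w-color (suc (suc a)) = cs-color a (joined (suc (suc a)))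
        D-old′ : ∀ a → d ≤ level (lookup (u ∷ w i ∷ cs) a)
        D-old′ zero          = <⇒≤ (D-old zero)
        D-old′ (suc zero)    = ≤-reflexive (sym level-w)
        D-old′ (suc (suc a)) = <⇒≤ (D-old (suc (suc a)))
        -- The invariant passes to the new vertex: `beyond` keeps its later neighbours from lying
        -- left of `hi′`, and `saturated` gives these edges colours already known to be in `L`.
        w-beyond : ∀ {x} → Adj (w i) x → Adj u x → level x < d → w i ≺ x × color (w i) x ∈ L
        w-beyond w-x _ x<d with saturated w-x
        ... | a , same =
          ≺-⊁-trans Λ below (beyond w-x λ { b refl → <⇒≱ x<d (<⇒≤ (D-old b)) }) ,
          subst (_∈ L) (sym same) (w-color a)
        open Chain (chain d (w i) (<⇒≤ d<K) (proj₂ (proj₂ (w-child i)) (suc zero)) D-old′ w-beyond)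

    -- Two chains with the same colours.

    module _ {u₁ u₂ hi c₀ hi₁ : V} (x₁ : Chain u₁ c₁ (3 + j)) (x₂ : Chain u₂ c₁ (3 + j))
      (u₁-middle : Middle Λ hi₁ (c₀ ∷ c₁ ∷ cs) u₁) (u₁≺u₂ : u₁ ≺ u₂) (u₂≺hi : u₂ ≺ hi)
      (hi≼₁ : ∀ {n : ℕ} → n < 3 + j → ¬ (Chain.vertex x₁ (suc n) ≺ hi))
      (hi≼₂ : ∀ {n : ℕ} → n < 3 + j → ¬ (Chain.vertex x₂ (suc n) ≺ hi))
      (same : ∀ {n : ℕ} → n < 3 + j → ∀ (a : Fin (2 + j)) →
        color (lookup (u₁ ∷ Chain.vertex x₁ n ∷ cs) a) (Chain.vertex x₁ (suc n)) ≡
        color (lookup (u₂ ∷ Chain.vertex x₂ n ∷ cs) a) (Chain.vertex x₂ (suc n))) where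

      private
        K : ℕ
        K = 3 + j
        module X₁ = Chain x₁
        module X₂ = Chain x₂
        module M₁ {n : ℕ} (n<K : n < K) = Middle (proj₂ (X₁.middle n<K))
        module M₂ {n : ℕ} (n<K : n < K) = Middle (proj₂ (X₂.middle n<K))

      -- If the claim fails at `suc n`, let `a` be the parent position whose colour the edge from
      -- `X₁.vertex (suc n)` to its successor repeats. The edge of the second chain at position `a`
      -- has this colour too and covers that edge.
      alternate : ∀ {n} → n < K → X₂.vertex n ≺ X₁.vertex (suc n)
      alternate {zero}  n<K =
        subst (_≺ _) (trans X₁.start (sym X₂.start)) (M₁.right n<K (suc zero))
      alternate {suc n} n<K with compare (X₂.vertex (suc n)) (X₁.vertex (suc (suc n)))
      ... | tri< lt _ _ = lt
      -- Equality is impossible because the two vertices stem from different rounds.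
      ... | tri≈ _ eq _ = contradiction
        (+-cancelˡ-≡ (level (X₂.vertex (suc n))) _ _ (trans (X₂.level-≡ (<⇒≤ n<K))
          (trans (sym (X₁.level-≡ n<K)) (cong (λ x → level x + _) (sym eq)))))
        λ ()
      ... | tri> _ _ gt with M₁.saturated (<⇒≤ n<K) (M₁.joined n<K (suc zero))
      ... | a , used = ⊥-elim (noNest (M₂.joined (<⇒≤ n<K) a) (M₁.joined n<K (suc zero))
              (sym (trans used (same (<⇒≤ n<K) a))) (parent≺ a) (M₁.right n<K (suc zero)) gt)
        where
        -- The three kinds of parents: `u₂` lies left of `hi`, which no later chain vertex precedes;
        -- the previous chain vertex is handled by induction; `cs` is shared by both chains.
        parent≺ : ∀ a → lookup (u₂ ∷ X₂.vertex n ∷ cs) a ≺ X₁.vertex (suc n)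
        parent≺ zero          = ≺-⊁-trans Λ u₂≺hi (hi≼₁ (<⇒≤ n<K))
        parent≺ (suc zero)    = alternate (<⇒≤ n<K)
        parent≺ (suc (suc a)) = M₁.right (<⇒≤ n<K) (suc (suc a))

      later≺ : ∀ {m n} → m < n → n ≤ K → X₂.vertex m ≺ X₁.vertex n
      later≺ {m} {suc n} (s≤s m≤n) n<K with m≤n⇒m<n∨m≡n m≤n
      ... | inj₁ m<n  = ≺-trans (later≺ m<n (<⇒≤ n<K)) (M₁.right n<K (suc zero))
      ... | inj₂ refl = alternate n<K

      -- The number of rounds `3 + j` exceeds by one the number of colours available at the
      -- saturated vertex `u₁`, which forces two edges from `u₁` to its chain to have the same
      -- colour.
      chains-conflict : ⊥
      chains-conflict with pigeonhole (n<1+n (2 + j)) (λ n → proj₁ (used n))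
        where
        used : ∀ n → ∃[ a ] color u₁ (X₁.vertex (suc (toℕ n))) ≡ color (lookup (c₀ ∷ c₁ ∷ cs) a) u₁
        used n = Middle.saturated u₁-middle (M₁.joined (toℕ<n n) zero)
      ... | m , n , m<n , eq = noNest
        (M₁.joined (toℕ<n n) zero) (M₂.joined (toℕ<n m) zero)
        (trans (trans (proj₂ (Middle.saturated u₁-middle (M₁.joined (toℕ<n n) zero)))
          (trans (cong (λ a → color (lookup (c₀ ∷ c₁ ∷ cs) a) u₁) (sym eq))
            (sym (proj₂ (Middle.saturated u₁-middle (M₁.joined (toℕ<n m) zero))))))
          (same (toℕ<n m) zero))
        u₁≺u₂ (≺-⊁-trans Λ u₂≺hi (hi≼₂ (toℕ<n m))) (later≺ (s≤s m<n) (toℕ<n n))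

-- Excluding many children on one side of a clique.

lookup-injective : ∀ {A : Set} {xs : List A} → Unique xs → ∀ i j →
  List.lookup xs i ≡ List.lookup xs j → i ≡ j
lookup-injective (_ ∷ _)    zero    zero    _  = refl
lookup-injective (x∉ ∷ _)   zero    (suc j) eq = contradiction eq (All.lookup x∉ (∈-lookup j))
lookup-injective (x∉ ∷ _)   (suc i) zero    eq = contradiction (sym eq) (All.lookup x∉ (∈-lookup i))
lookup-injective (_ ∷ xs!)  (suc i) (suc j) eq = cong suc (lookup-injective xs! i j eq)

module _ {V : Set} {Adj : Rel V 0ℓ}
  (Adj-sym : ∀ {u v} → Adj u v → Adj v u) (Adj-irrefl : ∀ {v} → ¬ Adj v v) where

  module _ {k} (Λ : LocalLayout Adj k) where
    open LocalLayout Λ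

    -- The colours at the vertices of C bound the number of colour patterns of a chain, because
    -- every vertex of the chain is saturated.
    palettes : ∀ {m} → Vec V m → List Color
    palettes []      = []
    palettes (v ∷ D) = palette v ++ palettes D

    length-palettes : ∀ {m} (D : Vec V m) → length (palettes D) ≤ m * k
    length-palettes []      = z≤n
    length-palettes (v ∷ D) = ≤-trans (≤-reflexive (length-++ (palette v)))
      (+-mono-≤ (palette-length v) (length-palettes D))

    color∈palettes : ∀ {m} (D : Vec V m) a {x} → Adj (lookup D a) x →
      color (lookup D a) x ∈ palettes D
    color∈palettes (v ∷ D) zero    v-x = ∈-++⁺ˡ (color∈palette v-x)
    color∈palettes (v ∷ D) (suc a) v-x = ∈-++⁺ʳ (palette v) (color∈palettes D a v-x)

  module _ {j : ℕ} (Λ : LocalLayout Adj (2 + j)) (level : V → ℕ) (N B m : ℕ)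
    (k²≤B : (2 + j) * (2 + j) ≤ B) (<N : B ^ (2 + j) * 2 < N) (<m : B ^ ((3 + j) * (2 + j)) * 1 < m)
    (c₀ c₁ : V) (cs : Vec V j) (C-clique : Clique Adj (c₀ ∷ c₁ ∷ cs))
    (C-old : ∀ (a : Fin (2 + j)) → 3 + j ≤ level (lookup (c₀ ∷ c₁ ∷ cs) a)) where
    open LocalLayout Λ
    open IsStrictTotalOrder ≺-isSTO using (compare) renaming (trans to ≺-trans)

    private
      k : ℕ
      k = 2 + j

      C : Vec V k
      C = c₀ ∷ c₁ ∷ cs

      L : List Color
      L = palettes Λ C

      L≤B : length L ≤ B
      L≤B = ≤-trans (length-palettes Λ C) k²≤B

      ChainFrom : V → Set
      ChainFrom u = Chain Adj-sym Adj-irrefl Λ level N B L L≤B <N c₁ cs u c₁ (suc k)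

    module _ (hi : V) (us : List V) (us! : Unique us) (m≤us : m ≤ length us)
      (u-middle : ∀ {u : V} → u ∈ us → Middle Adj-sym Adj-irrefl Λ hi C u) where

      private
        u : Fin (length us) → V
        u = List.lookup us

        u∈ : ∀ i → u i ∈ us
        u∈ i = ∈-lookup i

        module M (i : Fin (length us)) = Middle (u-middle (u∈ i))

      u-beyond : ∀ i {x} → Adj (u i) x → level x < suc k → ¬ (x ≺ hi) × color (u i) x ∈ L
      u-beyond i u-x fresh with M.saturated i u-x
      ... | a , same = M.beyond i u-x (λ { b refl → <⇒≱ fresh (C-old b) }) ,
                       subst (_∈ L) (sym same) (color∈palettes Λ C a (M.joined i a))

      chainAt : (∀ {u} → u ∈ us → suc k ≤ level u) →
        (∀ {u} → u ∈ us → Rich Adj level N (suc k) (u ∷ c₁ ∷ cs)) → ∀ i → ChainFrom (u i)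
      chainAt u-old u-rich i = chain Adj-sym Adj-irrefl Λ level N B L L≤B <N c₁ cs
        (suc k) (M.below i) (λ a → M.right i (suc (suc a))) (u-beyond i)
        (λ a → color∈palettes Λ C (suc (suc a)))
        (suc k) c₁ ≤-refl (u-rich (u∈ i))
        (λ { zero → u-old (u∈ i) ; (suc a) → C-old (suc a) })
        (λ c₁-x u-x fresh →
          ≺-trans (M.right i (suc zero))
            (≺-⊁-trans Adj-sym Adj-irrefl Λ (M.below i) (proj₁ (u-beyond i u-x fresh))) ,
          color∈palettes Λ C (suc zero) c₁-x)

      module _ (x : ∀ (i : Fin (length us)) → ChainFrom (u i)) where

        private
          module X (i : Fin (length us)) = Chain (x i)

        pattern-color : Fin (length us) → Fin (suc k) × Fin k → Color
        pattern-color i (n , a) =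
          color (lookup (u i ∷ X.vertex i (toℕ n) ∷ cs) a) (X.vertex i (suc (toℕ n)))

        chain-beyond : ∀ i {n} → n < suc k → ¬ (X.vertex i (suc n) ≺ hi)
        chain-beyond i n<K = proj₁ (u-beyond i (Middle.joined (proj₂ (X.middle i n<K)) zero)
          (s≤s (m+n≤o⇒m≤o _ (s≤s⁻¹ (≤-reflexive (trans (sym (+-suc _ _)) (X.level-≡ i n<K)))))))

        conflict : ∀ i i′ → u i ≺ u i′ →
          (∀ p → pattern-color i (remQuot k p) ≡ pattern-color i′ (remQuot k p)) → ⊥
        conflict i i′ u≺u′ same = chains-conflict Adj-sym Adj-irrefl Λ level N B L L≤B <N c₁ cs
          (x i) (x i′) (u-middle (u∈ i)) u≺u′ (M.below i′)
          (chain-beyond i) (chain-beyond i′) same′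
          where
          same′ : ∀ {n} → n < suc k → ∀ a →
            color (lookup (u i ∷ X.vertex i n ∷ cs) a) (X.vertex i (suc n)) ≡
            color (lookup (u i′ ∷ X.vertex i′ n ∷ cs) a) (X.vertex i′ (suc n))
          same′ {n} n<K a = subst (λ n → color (lookup (u i ∷ X.vertex i n ∷ cs) a) (X.vertex i (suc n)) ≡
              color (lookup (u i′ ∷ X.vertex i′ n ∷ cs) a) (X.vertex i′ (suc n)))
            (toℕ-fromℕ< n<K)
            (subst (λ p → pattern-color i p ≡ pattern-color i′ p) (remQuot-combine (fromℕ< n<K) a)
              (same (combine (fromℕ< n<K) a)))

        -- A chain has `suc k * k` colours, indexed by a round and a parent position and flattened
        -- through `remQuot`. Since `m` exceeds the number of possible patterns, two of the middle
        -- children have chains with the same colours.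
        no-middle-children : ⊥
        no-middle-children
          with popular-pattern _≟_ L (suc k * k) 1 (λ i p → pattern-color i (remQuot k p))
                 (List.allFin (length us)) (Unique.allFin⁺ _)
                 (λ {i} _ p → X.color∈ i (toℕ<n (proj₁ (remQuot {suc k} k p))) (proj₂ (remQuot {suc k} k p)))
                 (≤-trans (s≤s (*-monoˡ-≤ 1 (^-monoˡ-≤ (suc k * k) L≤B)))
                   (≤-trans <m (≤-trans m≤us (≤-reflexive (sym (length-tabulate id))))))
        ... | _ ∷ [] , _ , _ , s≤s () , _
        ... | i ∷ i′ ∷ _ , _ , (i≢i′ ∷ _) ∷ _ , _ , const with compare (u i) (u i′)
        ...   | tri< u≺u′ _ _ = conflict i i′ u≺u′ (const (here refl) (there (here refl)))
        ...   | tri≈ _ u≡u′ _ = i≢i′ (lookup-injective us! i i′ u≡u′)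
        ...   | tri> _ _ u≻u′ = conflict i′ i u≻u′ (const (there (here refl)) (here refl))

    -- A first pigeonhole, on the edges to `C`, produces `m` middle children with a common `hi`; a
    -- second, on their chains, produces the conflict.
    no-right-children : (us : List V) → Unique us → B ^ k * suc m < length us →
      (∀ {u} → u ∈ us → Joined Adj C u × (∀ a → lookup C a ≺ u) ×
        suc k ≤ level u × Rich Adj level N (suc k) (u ∷ c₁ ∷ cs)) →
      ⊥
    no-right-children us us! many child =
      let hi , ms , ms⊆ , ms! , m≤ms , ms-middle =
            middles Adj-sym Adj-irrefl Λ L L≤B m C C-clique us us!
              (λ u∈ → let C-u , C≺u , _ = child u∈
                      in C-u , C≺u , λ a → color∈palettes Λ C a (C-u a))
              many
      in no-middle-children hi ms ms! m≤ms ms-middle (chainAt hi ms ms! m≤ms ms-middle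
           (λ u∈ → proj₁ (proj₂ (proj₂ (child (ms⊆ u∈)))))
           (λ u∈ → proj₂ (proj₂ (proj₂ (child (ms⊆ u∈))))))

-- Vertex vectors as vertex subsets.

∣[]≔inside∣ : ∀ {n} (p : Subset n) x → lookup p x ≡ outside → ∣ p [ x ]≔ inside ∣ ≡ suc ∣ p ∣
∣[]≔inside∣ (outside ∷ p) zero    _  = refl
∣[]≔inside∣ (inside ∷ p)  (suc x) eq = cong suc (∣[]≔inside∣ p x eq)
∣[]≔inside∣ (outside ∷ p) (suc x) eq = ∣[]≔inside∣ p x eq

vertexSet : ∀ {n m} → Vec (Fin n) m → Subset n
vertexSet []      = ∅
vertexSet (x ∷ D) = vertexSet D [ x ]≔ inside

∈-vertexSet⁻ : ∀ {n m} (D : Vec (Fin n) m) {y} → y ∈ˢ vertexSet D → ∃[ a ] lookup D a ≡ y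
∈-vertexSet⁻ []      y∈ = contradiction y∈ ∉⊥
∈-vertexSet⁻ (x ∷ D) {y} y∈ with x Fin.≟ y
... | yes x≡y = zero , x≡y
... | no  x≢y =
  let a , eq = ∈-vertexSet⁻ D (lookup⇒[]= y _
                 (trans (sym (lookup∘update′ (x≢y ∘ sym) (vertexSet D) inside)) ([]=⇒lookup y∈)))
  in suc a , eq

∈-vertexSet⁺ : ∀ {n m} (D : Vec (Fin n) m) a → lookup D a ∈ˢ vertexSet D
∈-vertexSet⁺ (x ∷ D) zero    = lookup⇒[]= x _ (lookup∘update x (vertexSet D) inside)
∈-vertexSet⁺ (x ∷ D) (suc a) with lookup D a Fin.≟ x
... | yes eq rewrite eq = lookup⇒[]= x _ (lookup∘update x (vertexSet D) inside)
... | no  ≢x = lookup⇒[]= _ _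
  (trans (lookup∘update′ ≢x (vertexSet D) inside) ([]=⇒lookup (∈-vertexSet⁺ D a)))

∣vertexSet∣ : ∀ {n m} (D : Vec (Fin n) m) → Injective _≡_ _≡_ (lookup D) → ∣ vertexSet D ∣ ≡ m
∣vertexSet∣ {n} []  _     = ∣⊥∣≡0 n
∣vertexSet∣ (x ∷ D) D-inj =
  trans (∣[]≔inside∣ (vertexSet D) x x∉) (cong suc (∣vertexSet∣ D (suc-injective ∘ D-inj)))
  where
  x∉ : lookup (vertexSet D) x ≡ outside
  x∉ with lookup (vertexSet D) x in eq
  ... | outside = refl
  ... | inside with ∈-vertexSet⁻ D (lookup⇒[]= x _ eq)
  ...   | a , a≡x with () ← D-inj {zero} {suc a} (sym a≡x)

module _ {n} (G : Graph n) where

  clique? : ∀ {m} (D : Vec (Fin n) m) → Dec (Clique (Adj G) D)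
  clique? D = map′ (λ f {a} {b} → f a b) (λ f a b → f {a} {b})
    (all? λ a → all? λ b → ¬? (a Fin.≟ b) →-dec adj? G (lookup D a) (lookup D b))

  clique-injective : ∀ {m} (D : Vec (Fin n) m) → Clique (Adj G) D → Injective _≡_ _≡_ (lookup D)
  clique-injective D D-clique {a} {b} eq with a Fin.≟ b
  ... | yes a≡b = a≡b
  ... | no  a≢b = contradiction (D-clique a≢b) (adj-irrefl G eq)

  clique⇒IsClique : ∀ {m} (D : Vec (Fin n) m) → Clique (Adj G) D → IsClique G (vertexSet D)
  clique⇒IsClique D D-clique u v u∈ v∈ u≢v
    with ∈-vertexSet⁻ D u∈ | ∈-vertexSet⁻ D v∈
  ... | a , refl | b , refl = D-clique λ { refl → u≢v refl }

  replace-clique : ∀ {m} (D : Vec (Fin n) m) {w} → Clique (Adj G) D → Joined (Adj G) D w →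
    ∀ c → Clique (Adj G) (D [ c ]≔ w)
  replace-clique D {w} D-clique D-w c {a} {b} a≢b with a Fin.≟ c | b Fin.≟ c
  ... | yes refl | yes refl = contradiction refl a≢b
  ... | yes refl | no  b≢c  rewrite lookup∘update c D w | lookup∘update′ b≢c D w = adj-sym G (D-w b)
  ... | no  a≢c  | yes refl rewrite lookup∘update c D w | lookup∘update′ a≢c D w = D-w a
  ... | no  a≢c  | no  b≢c
    rewrite lookup∘update′ a≢c D w | lookup∘update′ b≢c D w = D-clique a≢b

-- Construction of the enriched tree.

record LevelledTree (k : ℕ) : Set where
  field
    {size} : ℕ
    tree   : KTree k size
    level  : Fin size → ℕ

  edge : Fin size → Fin size → Set
  edge = Adj (graph tree)

open LevelledTree

infix 4 _↪_
record _↪_ {k} (X Y : LevelledTree k) : Set where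
  field
    to        : Fin (size X) → Fin (size Y)
    injective : Injective _≡_ _≡_ to
    adj       : ∀ {u v} → edge X u v → edge Y (to u) (to v)
    level-to  : ∀ v → level Y (to v) ≡ level X v

open _↪_

↪-refl : ∀ {k} {X : LevelledTree k} → X ↪ X
↪-refl = record { to = id ; injective = id ; adj = id ; level-to = λ _ → refl }

↪-trans : ∀ {k} {X Y Z : LevelledTree k} → X ↪ Y → Y ↪ Z → X ↪ Z
↪-trans e f = record
  { to        = to f ∘ to e
  ; injective = injective e ∘ injective f
  ; adj       = adj f ∘ adj e
  ; level-to  = λ v → trans (level-to f (to e v)) (level-to e v)
  }

map-clique : ∀ {k m} {X Y : LevelledTree k} (e : X ↪ Y) (D : Vec (Fin (size X)) m) →
  Clique (edge X) D → Clique (edge Y) (map (to e) D)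
map-clique e D D-clique {a} {b} a≢b
  rewrite lookup-map a (to e) D | lookup-map b (to e) D = adj e (D-clique a≢b)

Children : ∀ {k m} {X Y : LevelledTree k} → X ↪ Y → Vec (Fin (size X)) m → (N d : ℕ) → Set
Children {Y = Y} e D N d = Σ[ w ∈ (Fin N → Fin (size Y)) ] Injective _≡_ _≡_ w ×
  (∀ i → (∀ a → edge Y (to e (lookup D a)) (w i)) × level Y (w i) ≡ d)

push-children : ∀ {k m N d} {X Y Z : LevelledTree k} (e : X ↪ Y) (f : Y ↪ Z)
  (D : Vec (Fin (size X)) m) → Children e D N d → Children (↪-trans e f) D N d
push-children e f D (w , w-inj , w-child) =
  to f ∘ w , w-inj ∘ injective f ,
  λ i → adj f ∘ proj₁ (w-child i) , trans (level-to f (w i)) (proj₂ (w-child i))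

addChild : ∀ {k} (d : ℕ) (X : LevelledTree k) (D : Vec (Fin (size X)) k) → Clique (edge X) D →
  Σ[ Y ∈ LevelledTree k ] Σ[ e ∈ X ↪ Y ] Σ[ w ∈ Fin (size Y) ]
    (∀ v → to e v ≢ w) × (∀ a → edge Y (to e (lookup D a)) w) × level Y w ≡ d
addChild d X D D-clique =
  record { tree  = extend (tree X) (vertexSet D) (clique⇒IsClique (graph (tree X)) D D-clique)
                     (∣vertexSet∣ D (clique-injective (graph (tree X)) D D-clique))
         ; level = λ { zero → d ; (suc v) → level X v } } ,
  record { to = suc ; injective = suc-injective ; adj = id ; level-to = λ _ → refl } ,
  zero , (λ _ ()) , ∈-vertexSet⁺ D , refl

addChildren : ∀ {k} (N d : ℕ) (X : LevelledTree k) (D : Vec (Fin (size X)) k) → Clique (edge X) D →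
  Σ[ Y ∈ LevelledTree k ] Σ[ e ∈ X ↪ Y ] Children e D N d
addChildren zero    d X D D-clique = X , ↪-refl , (λ ()) , (λ { {()} }) , λ ()
addChildren {k} (suc N) d X D D-clique with addChildren N d X D D-clique
... | Y , e , w , w-inj , w-child with addChild d Y (map (to e) D) (map-clique e D D-clique)
...   | Z , f , z , z-new , z-joined , z-level =
  Z , ↪-trans e f , w′ , w′-inj , w′-child
  where
  w′ : Fin (suc N) → Fin (size Z)
  w′ zero    = z
  w′ (suc i) = to f (w i)
  w′-inj : Injective _≡_ _≡_ w′
  w′-inj {zero}  {zero}  _  = refl
  w′-inj {zero}  {suc j} eq = contradiction (sym eq) (z-new (w j))
  w′-inj {suc i} {zero}  eq = contradiction eq (z-new (w i))
  w′-inj {suc i} {suc j} eq = cong suc (w-inj (injective f eq))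
  w′-child : ∀ i → (∀ a → edge Z (to f (to e (lookup D a))) (w′ i)) × level Z (w′ i) ≡ d
  w′-child zero    =
    (λ a → subst (λ v → edge Z (to f v) z) (lookup-map a (to e) D) (z-joined a)) , z-level
  w′-child (suc i) = adj f ∘ proj₁ (w-child i) , trans (level-to f (w i)) (proj₂ (w-child i))

-- The cliques are those of the fixed tree `X`, while children are attached in a growing tree; the
-- embedding `e` records where `X` lies in it.
addChildrenToAll : ∀ {k} (N d : ℕ) {X Y : LevelledTree k} (e : X ↪ Y)
  (Ds : List (Vec (Fin (size X)) k)) →
  Σ[ Z ∈ LevelledTree k ] Σ[ f ∈ Y ↪ Z ]
    (∀ {D} → D ∈ Ds → Clique (edge X) D → Children (↪-trans e f) D N d)
addChildrenToAll N d {Y = Y} e [] = Y , ↪-refl , λ ()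
addChildrenToAll N d {X} {Y} e (D ∷ Ds) with clique? (graph (tree X)) D
... | no ¬clique =
  let Z , f , children = addChildrenToAll N d e Ds
  in Z , f , λ { (here refl) D-clique → contradiction (λ {a} {b} → D-clique {a} {b}) ¬clique
               ; (there D∈) → children D∈ }
... | yes clique =
  let Y′ , e′ , w , w-inj , w-child = addChildren N d Y (map (to e) D) (map-clique e D clique)
      Z , f , children = addChildrenToAll N d (↪-trans e e′) Ds
  in Z , ↪-trans e′ f ,
     λ { (here refl) _ → push-children (↪-trans e e′) f D
           (w , w-inj , λ i →
             (λ a → subst (λ v → edge Y′ (to e′ v) (w i)) (lookup-map a (to e) D)
                      (proj₁ (w-child i) a)) ,
             proj₂ (w-child i))
       ; (there D′∈) → children D′∈ }

allVecs : ∀ n m → List (Vec (Fin n) m)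
allVecs n zero    = [] ∷ []
allVecs n (suc m) = cartesianProductWith _∷_ (List.allFin n) (allVecs n m)

∈-allVecs : ∀ {n m} (D : Vec (Fin n) m) → D ∈ allVecs n m
∈-allVecs []      = here refl
∈-allVecs (x ∷ D) = ∈-cartesianProductWith⁺ _∷_ (∈-allFin x) (∈-allVecs D)

-- One round serves all `k`-cliques of `X`; the remaining rounds start from the resulting tree `Y`,
-- so they also serve the cliques in which a child has replaced a vertex.
enrich : ∀ {k} (N d : ℕ) (X : LevelledTree k) →
  Σ[ Y ∈ LevelledTree k ] Σ[ e ∈ X ↪ Y ]
    (∀ (D : Vec (Fin (size X)) k) → Clique (edge X) D → Rich (edge Y) (level Y) N d (map (to e) D))
enrich N zero    X = X , ↪-refl , λ _ _ → tt
enrich {k} N (suc d) X =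
  let Y , e , children = addChildrenToAll N d ↪-refl (allVecs (size X) k)
      Z , f , rich     = enrich N d Y
  in Z , ↪-trans e f , λ D D-clique →
     let w , w-inj , w-child = children (∈-allVecs D) D-clique
         D-w : ∀ i → Joined (edge Y) (map (to e) D) (w i)
         D-w i a = subst (λ v → edge Y v (w i)) (sym (lookup-map a (to e) D)) (proj₁ (w-child i) a)
     in map-clique (↪-trans e f) D D-clique ,
        to f ∘ w , w-inj ∘ injective f , λ i →
          (λ a → subst (λ v → edge Z v (to f (w i))) (sym (lookup-map a (to f ∘ to e) D))
                   (adj f (proj₁ (w-child i) a))) ,
          trans (level-to f (w i)) (proj₂ (w-child i)) ,
          λ a → subst (Rich (edge Z) (level Z) N d)
                  (trans (map-[]≔ (to f) (map (to e) D) a)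
                    (cong (_[ a ]≔ to f (w i)) (sym (map-∘ (to f) (to e) D))))
                  (rich (map (to e) D [ a ]≔ w i)
                    (replace-clique (graph (tree Y)) (map (to e) D) (map-clique e D D-clique) (D-w i) a))

-- Subsets as lists without repetition.

elements : ∀ {n} → Subset n → List (Fin n)
elements []            = []
elements (inside ∷ p)  = zero ∷ List.map suc (elements p)
elements (outside ∷ p) = List.map suc (elements p)

length-elements : ∀ {n} (p : Subset n) → length (elements p) ≡ ∣ p ∣
length-elements []            = refl
length-elements (inside ∷ p)  = cong suc (trans (length-map suc (elements p)) (length-elements p))
length-elements (outside ∷ p) = trans (length-map suc (elements p)) (length-elements p)

elements-unique : ∀ {n} (p : Subset n) → Unique (elements p)
elements-unique []            = []
elements-unique (inside ∷ p)  =
  All.map⁺ (All.universal (λ _ ()) (elements p)) ∷ Unique.map⁺ suc-injective (elements-unique p)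
elements-unique (outside ∷ p) = Unique.map⁺ suc-injective (elements-unique p)

∈-elements⁺ : ∀ {n} {p : Subset n} {x} → x ∈ˢ p → x ∈ elements p
∈-elements⁺ {p = inside ∷ p}  here       = here refl
∈-elements⁺ {p = inside ∷ p}  (there x∈) = there (∈-map⁺ suc (∈-elements⁺ x∈))
∈-elements⁺ {p = outside ∷ p} (there x∈) = ∈-map⁺ suc (∈-elements⁺ x∈)

∈-elements⁻ : ∀ {n} (p : Subset n) {x} → x ∈ elements p → x ∈ˢ p
∈-elements⁻ (inside ∷ p)  (here refl) = here
∈-elements⁻ (inside ∷ p)  (there x∈) with _ , y∈ , refl ← ∈-map⁻ suc x∈ = there (∈-elements⁻ p y∈)
∈-elements⁻ (outside ∷ p) x∈         with _ , y∈ , refl ← ∈-map⁻ suc x∈ = there (∈-elements⁻ p y∈)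

listed : ∀ {A : Set} {k} (xs : List A) → Unique xs → length xs ≡ k →
  Σ[ D ∈ Vec A k ] (∀ a → lookup D a ∈ xs) × (∀ {a b} → a ≢ b → lookup D a ≢ lookup D b)
listed []       _          refl = [] , (λ ()) , λ { {()} }
listed {A} (x ∷ xs) (x∉ ∷ xs!) refl with listed xs xs! refl
... | D , D∈ , distinct = x ∷ D , (λ { zero → here refl ; (suc a) → there (D∈ a) }) , distinct′
  where
  distinct′ : ∀ {a b} → a ≢ b → lookup (x ∷ D) a ≢ lookup (x ∷ D) b
  distinct′ {zero}  {zero}  a≢b = contradiction refl a≢b
  distinct′ {zero}  {suc b} _   = All.lookup x∉ (D∈ b)
  distinct′ {suc a} {zero}  _   = All.lookup x∉ (D∈ a) ∘ sym
  distinct′ {suc a} {suc b} a≢b = distinct (a≢b ∘ cong suc)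

-- Queue layouts as local layouts, and their restriction to subgraphs.

module _ {n} {G : Graph n} (L : QueueLayout G) where
  open QueueLayout L

  ∈-queuesAt⁺ : ∀ {u v} → Adj G u v → queueOf u v ∈ˢ queuesAt u
  ∈-queuesAt⁺ {u} {v} u-v = lookup⇒[]= (queueOf u v) _
    (trans (lookup∘tabulate _ (queueOf u v))
      (dec-true (any? λ x → adj? G u x ×-dec (queueOf u x Fin.≟ queueOf u v)) (v , u-v , refl)))

  ∈-queuesAt⁻ : ∀ {u i} → i ∈ˢ queuesAt u → ∃[ v ] Adj G u v × queueOf u v ≡ i
  ∈-queuesAt⁻ {u} {i} i∈
    with any? (λ x → adj? G u x ×-dec (queueOf u x Fin.≟ i))
       | trans (sym (lookup∘tabulate (λ i → does (any? λ v → adj? G u v ×-dec (queueOf u v Fin.≟ i))) i))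
               ([]=⇒lookup i∈)
  ... | yes found | _ = found
  ... | no  _     | ()

  localLayout : ∀ {ℓ k} → IsLocal ℓ L → ℓ ≤ k → LocalLayout (Adj G) k
  localLayout L-local ℓ≤k = record
    { _≟_            = Fin._≟_
    ; color          = queueOf
    ; color-sym      = queueOf-sym
    ; palette        = λ v → elements (queuesAt v)
    ; palette-length = λ v →
        ≤-trans (≤-reflexive (length-elements (queuesAt v))) (≤-trans (L-local v) ℓ≤k)
    ; color∈palette  = ∈-elements⁺ ∘ ∈-queuesAt⁺
    ; _≺_            = _≺_
    ; ≺-isSTO        = ≺-isSTO
    ; noNest         = λ uv xy same u≺x x≺y y≺v →
        isQueue _ (uv , refl) (xy , sym same) (inj₁ (u≺x , x≺y , y≺v))
    }

module _ {m n} {G : Graph m} {H : Graph n} (f : Fin m → Fin n) (f-injective : Injective _≡_ _≡_ f)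
  (f-adj : ∀ {u v} → Adj G u v → Adj H (f u) (f v)) where

  -- The hypothesis speaks of layouts of the original tree; a layout of the enriched tree is pulled
  -- back to it.
  restrict : QueueLayout H → QueueLayout G
  restrict L = record
    { _≺_         = λ u v → f u ≺ f v
    ; ≺-isSTO     = isStrictTotalOrderᶜ record
      { isEquivalence = isEquivalence ; trans = IsStrictTotalOrder.trans ≺-isSTO ; compare = compare′ }
    ; #queues     = #queues
    ; queueOf     = λ u v → queueOf (f u) (f v)
    ; queueOf-sym = queueOf-sym ∘ f-adj
    ; isQueue     = λ { i (uv , uv∈) (xy , xy∈) → isQueue i (f-adj uv , uv∈) (f-adj xy , xy∈) }
    }
    where
    open QueueLayout L
    compare′ : ∀ u v → Tri (f u ≺ f v) (u ≡ v) (f v ≺ f u)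
    compare′ u v with IsStrictTotalOrder.compare ≺-isSTO (f u) (f v)
    ... | tri< lt ≢ ≯ = tri< lt (≢ ∘ cong f) ≯
    ... | tri≈ ≮ eq ≯ = tri≈ ≮ (f-injective eq) ≯
    ... | tri> ≮ ≢ gt = tri> ≮ (≢ ∘ cong f) gt

  restrict-local : ∀ {ℓ} L → IsLocal ℓ L → IsLocal ℓ (restrict L)
  restrict-local L L-local u = ≤-trans (p⊆q⇒∣p∣≤∣q∣ sub) (L-local (f u))
    where
    sub : ∀ {i} → i ∈ˢ QueueLayout.queuesAt (restrict L) u → i ∈ˢ QueueLayout.queuesAt L (f u)
    sub i∈ with _ , u-v , refl ← ∈-queuesAt⁻ (restrict L) i∈ = ∈-queuesAt⁺ L (f-adj u-v)

-- A tree without local layout.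

child-adj : ∀ {k n} {T : KTree k n} {u C} → Child T u C → ∀ {c} → c ∈ˢ C → Adj (graph T) c u
child-adj new         (there c∈) = c∈
child-adj (old child) (there c∈) = child-adj child c∈

module _ (j ℓ : ℕ) (ℓ≤k : ℓ ≤ 2 + j) (B m M N : ℕ) (k²≤B : (2 + j) * (2 + j) ≤ B)
  (<N : B ^ (2 + j) * 2 < N) (<m : B ^ ((3 + j) * (2 + j)) * 1 < m) (M-def : B ^ (2 + j) * suc m ≡ M)
  {n : ℕ} (T : KTree (2 + j) n)
  (forced : ∀ (L : QueueLayout (graph T)) → IsLocal ℓ L → ManyNonNestingChildren T L (suc (M + M)))
  where

  open LevelledTree
  open _↪_

  private
    k : ℕ
    k = 2 + j

    X : LevelledTree k
    -- The original vertices get a level above those of all `suc k` rounds, which are `k` down to 0.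
    X = record { tree = T ; level = λ _ → suc k }

  module _ {Y : LevelledTree k} (e : X ↪ Y)
    (rich : ∀ (D : Vec (Fin n) k) → Clique (edge X) D →
      Rich (edge Y) (level Y) N (suc k) (map (to e) D)) where

    one-sided : (Λ : LocalLayout (edge Y) k) (D : Vec (Fin n) k) → Clique (edge X) D →
      (us : List (Fin n)) → Unique us → M < length us →
      (∀ {u} → u ∈ us → Joined (edge X) D u ×
        (∀ a → LocalLayout._≺_ Λ (to e (lookup D a)) (to e u))) → ⊥
    one-sided Λ D@(c₀ ∷ c₁ ∷ cs) D-clique us us! M<us child =
      no-right-children (adj-sym (graph (tree Y))) (adj-irrefl (graph (tree Y)) refl)
        Λ (level Y) N B m k²≤B <N <m (to e c₀) (to e c₁) (map (to e) cs)
        (map-clique e D D-clique)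
        (λ a → ≤-reflexive (sym (trans (cong (level Y) (lookup-map a (to e) D)) (level-to e _))))
        (List.map (to e) us) (Unique.map⁺ (injective e) us!)
        (≤-trans (≤-reflexive (cong suc M-def)) (≤-trans M<us (≤-reflexive (sym (length-map (to e) us)))))
        child′
      where
      open LocalLayout Λ using (_≺_)
      child′ : ∀ {v} → v ∈ List.map (to e) us → Joined (edge Y) (map (to e) D) v ×
        (∀ a → lookup (map (to e) D) a ≺ v) × suc k ≤ level Y v ×
        Rich (edge Y) (level Y) N (suc k) (v ∷ map (to e) (c₁ ∷ cs))
      child′ v∈ =
        let u , u∈ , v≡eu = ∈-map⁻ (to e) v∈
            D-u , D≺u     = child u∈
        in subst (λ v → Joined (edge Y) (map (to e) D) v ×
             (∀ a → lookup (map (to e) D) a ≺ v) × suc k ≤ level Y v ×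
             Rich (edge Y) (level Y) N (suc k) (v ∷ map (to e) (c₁ ∷ cs))) (sym v≡eu)
           ((λ a → subst (λ c → edge Y c (to e u)) (sym (lookup-map a (to e) D)) (adj e (D-u a))) ,
            (λ a → subst (λ c → c ≺ to e u) (sym (lookup-map a (to e) D)) (D≺u a)) ,
            ≤-reflexive (sym (level-to e u)) ,
            -- The child `u` replaces `c₀`, so the chain can start at `c₁`.
            rich (u ∷ c₁ ∷ cs) (replace-clique (graph T) D D-clique D-u zero))

    no-local-layout : (L : QueueLayout (graph (tree Y))) → ¬ IsLocal ℓ L
    no-local-layout L L-local =
      let L′ = restrict {G = graph T} {H = graph (tree Y)} (to e) (injective e) (adj e) L
          C , C-clique , C-size , S , s≤S , S-children = forced L′
            (restrict-local {G = graph T} {H = graph (tree Y)} (to e) (injective e) (adj e) L L-local)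
          D , D∈ , distinct = listed (elements C) (elements-unique C) (trans (length-elements C) C-size)
      in sides D
           (λ {a} {b} a≢b →
             C-clique _ _ (∈-elements⁻ C (D∈ a)) (∈-elements⁻ C (D∈ b)) (distinct a≢b))
           (elements S) (elements-unique S) (≤-trans s≤S (≤-reflexive (sym (length-elements S))))
           (λ u∈ → let child , nonNesting = S-children (∈-elements⁻ S u∈)
                   in (λ a → child-adj child (∈-elements⁻ C (D∈ a))) ,
                      λ a b (a≺u , u≺b) → nonNesting
                        (_ , _ , ∈-elements⁻ C (D∈ a) , ∈-elements⁻ C (D∈ b) , a≺u , u≺b))
      where
      open QueueLayout L using (_≺_; ≺-isSTO)
      open IsStrictTotalOrder ≺-isSTO using (compare; _<?_)

      Λ : LocalLayout (edge Y) k
      Λ = localLayout L L-local ℓ≤k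

      -- A non-nesting child lies on the same side of all of `D`, so comparison with the first entry
      -- decides the side. Of more than `M + M` children more than `M` share a side; the left side
      -- is treated in the reversed layout.
      sides : (D : Vec (Fin n) k) → Clique (edge X) D →
        (us : List (Fin n)) → Unique us → M + M < length us →
        (∀ {u} → u ∈ us → Joined (edge X) D u ×
          (∀ a b → ¬ (to e (lookup D a) ≺ to e u × to e u ≺ to e (lookup D b)))) → ⊥
      sides D D-clique us us! <us child = by-majority (M ℕ.<? length (filter right? us))
        where
        right? : ∀ u → Dec (to e (lookup D zero) ≺ to e u)
        right? u = to e (lookup D zero) <? to e u

        apart : ∀ {u} → u ∈ us → ∀ a → ¬ to e (lookup D a) ≡ to e u
        apart u∈ a eq = adj-irrefl (graph T) (injective e eq) (proj₁ (child u∈) a)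

        right-of : ∀ {u} → u ∈ us → ∀ a → to e (lookup D a) ≺ to e u → ∀ b → to e (lookup D b) ≺ to e u
        right-of {u} u∈ a a≺u b with compare (to e (lookup D b)) (to e u)
        ... | tri< b≺u _ _ = b≺u
        ... | tri≈ _ eq _  = contradiction eq (apart u∈ b)
        ... | tri> _ _ u≺b = contradiction (a≺u , u≺b) (proj₂ (child u∈) a b)

        left-of : ∀ {u} → u ∈ us → ¬ to e (lookup D zero) ≺ to e u → ∀ b → to e u ≺ to e (lookup D b)
        left-of {u} u∈ ⊀u b with compare (to e (lookup D b)) (to e u)
        ... | tri< b≺u _ _ = contradiction (right-of u∈ b b≺u zero) ⊀u
        ... | tri≈ _ eq _  = contradiction eq (apart u∈ b)
        ... | tri> _ _ u≺b = u≺b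

        by-majority : Dec (M < length (filter right? us)) → ⊥
        by-majority (yes M<rights) = one-sided Λ D D-clique (filter right? us)
          (Unique.filter⁺ right? us!) M<rights λ u∈ →
            let u∈us , d₀≺u = ∈-filter⁻ right? {xs = us} u∈
            in proj₁ (child u∈us) , right-of u∈us zero d₀≺u
        by-majority (no M≮rights) = one-sided
          (reverse (adj-sym (graph (tree Y))) (adj-irrefl (graph (tree Y)) refl) Λ) D D-clique
          (filter (¬? ∘ right?) us) (Unique.filter⁺ (¬? ∘ right?) us!)
          (+-cancelˡ-< M _ _ (<-≤-trans <us (≤-trans
            (≤-reflexive (sym (length-filter-¬ right? us)))
            (+-monoˡ-≤ (length (filter (¬? ∘ right?) us)) (≮⇒≥ M≮rights)))))
          λ u∈ →
            let u∈us , d₀⊀u = ∈-filter⁻ (¬? ∘ right?) {xs = us} u∈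
            in proj₁ (child u∈us) , left-of u∈us d₀⊀u

non-local-tree : ∀ k ℓ → 1 < k → ℓ ≤ k →
  (∀ s → 0 < s → ∃[ n ] Σ[ T ∈ KTree k n ]
    (∀ (L : QueueLayout (graph T)) → IsLocal ℓ L → ManyNonNestingChildren T L s)) →
  ∃[ n ] Σ[ T ∈ KTree k n ] (∀ (L : QueueLayout (graph T)) → ¬ IsLocal ℓ L)
non-local-tree (suc zero)    ℓ (s≤s ()) _ _
non-local-tree (suc (suc j)) ℓ _ ℓ≤k forced =
  let k = suc (suc j)
      -- `B` bounds the colours at `k` vertices with `k` colours each, `m` exceeds the number of
      -- chain patterns, more than `M` children on one side yield `m` middle ones, and `N` children
      -- yield one. All are chosen before any layout.
      B = k * k
      m = suc (B ^ (suc k * k) * 1)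
      M = B ^ k * suc m
      N = suc (B ^ k * 2)
      n , T , T-forced = forced (suc (M + M)) (s≤s z≤n)
      Y , e , rich = enrich N (suc k) (record { tree = T ; level = λ _ → suc k })
  in LevelledTree.size Y , LevelledTree.tree Y ,
     no-local-layout j ℓ ℓ≤k B m M N ≤-refl ≤-refl ≤-refl refl T T-forced e rich

-- Existence of the exact local queue number.

least : ∀ {a} {P : ℕ → Set a} → (∀ m → Dec (P m)) → ∀ n → P n → ∃[ q ] (P q × (∀ m → P m → q ≤ m))
least P? zero    p = zero , p , λ _ _ → z≤n
least P? (suc n) p with P? zero
... | yes p₀ = zero , p₀ , λ _ _ → z≤n
... | no ¬p₀ with least (P? ∘ suc) n p
...   | q , pq , q≤ = suc q , pq , λ { zero p₀ → contradiction p₀ ¬p₀ ; (suc m) pm → s≤s (q≤ m pm) }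

Searchable : Set → Set₁
Searchable A = ∀ {P : A → Set} → (∀ x → Dec (P x)) → Dec (∃ P)

search-Bool : Searchable Bool
search-Bool P? = map′ (λ { (inj₁ p) → true , p ; (inj₂ p) → false , p })
  (λ { (true , p) → inj₁ p ; (false , p) → inj₂ p }) (P? true ⊎-dec P? false)

search-Vec : ∀ {A} → Searchable A → ∀ n → Searchable (Vec A n)
search-Vec search zero    P? = map′ (λ p → [] , p) (λ { ([] , p) → p }) (P? [])
search-Vec search (suc n) P? =
  map′ (λ { (x , xs , p) → x ∷ xs , p }) (λ { (x ∷ xs , p) → x , xs , p })
    (search λ x → search-Vec search n λ xs → P? (x ∷ xs))

Table : Set → ℕ → Set
Table A n = Vec (Vec A n) n

search-Table : ∀ {A} → Searchable A → ∀ n → Searchable (Table A n)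
search-Table search n = search-Vec (search-Vec search n) n

entry : ∀ {A n} → Table A n → Fin n → Fin n → A
entry t u v = lookup (lookup t u) v

table : ∀ {A n} → (Fin n → Fin n → A) → Table A n
table f = tabulate λ u → tabulate (f u)

entry∘table : ∀ {A n} (f : Fin n → Fin n → A) u v → entry (table f) u v ≡ f u v
entry∘table f u v rewrite lookup∘tabulate (λ u → tabulate (f u)) u = lookup∘tabulate (f u) v

∣∣-injection : ∀ {m n} (p : Subset m) (q : Subset n) (f : Fin m → Fin n) →
  (∀ {x} → x ∈ˢ p → f x ∈ˢ q) → (∀ {x y} → x ∈ˢ p → y ∈ˢ p → f x ≡ f y → x ≡ y) → ∣ p ∣ ≤ ∣ q ∣
∣∣-injection p q f f∈ f-inj = ≤-trans (≤-reflexive (sym (length-elements p)))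
  (≤-trans (injective⇒≤ {f = index ∘ position} λ {i} {i′} eq →
      lookup-injective (elements-unique p) i i′ (f-inj (x∈p i) (x∈p i′)
        (trans (lookup-index (position i))
          (trans (cong (List.lookup (elements q)) eq) (sym (lookup-index (position i′)))))))
    (≤-reflexive (length-elements q)))
  where
  x∈p : ∀ i → List.lookup (elements p) i ∈ˢ p
  x∈p i = ∈-elements⁻ p (∈-lookup i)
  position : ∀ i → f (List.lookup (elements p) i) ∈ elements q
  position i = ∈-elements⁺ (f∈ (x∈p i))

module _ {n} (G : Graph n) where

  -- With order and queues given as finite tables, every condition quantifies over vertices only and
  -- is decidable. One form of nesting suffices, since the other exchanges the two edges.
  IsLayout : ∀ {c} → Table Bool n → Table (Fin c) n → Set
  IsLayout order queues =
    (∀ u → ¬ u ≺ u) ×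
    (∀ u v w → u ≺ v → v ≺ w → u ≺ w) ×
    (∀ u v → u ≢ v → u ≺ v ⊎ v ≺ u) ×
    (∀ u v → Adj G u v → entry queues u v ≡ entry queues v u) ×
    (∀ u v x y → Adj G u v → Adj G x y → entry queues u v ≡ entry queues x y →
      ¬ (u ≺ x × x ≺ y × y ≺ v))
    where
    _≺_ : Fin n → Fin n → Set
    u ≺ v = entry order u v ≡ true

  isLayout? : ∀ {c} order (queues : Table (Fin c) n) → Dec (IsLayout order queues)
  isLayout? order queues =
    (all? λ u → ¬? (u ≺? u)) ×-dec
    (all? λ u → all? λ v → all? λ w → (u ≺? v) →-dec ((v ≺? w) →-dec (u ≺? w))) ×-dec
    (all? λ u → all? λ v → ¬? (u Fin.≟ v) →-dec ((u ≺? v) ⊎-dec (v ≺? u))) ×-dec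
    (all? λ u → all? λ v → adj? G u v →-dec (entry queues u v Fin.≟ entry queues v u)) ×-dec
    (all? λ u → all? λ v → all? λ x → all? λ y → adj? G u v →-dec (adj? G x y →-dec
      ((entry queues u v Fin.≟ entry queues x y) →-dec
        ¬? ((u ≺? x) ×-dec ((x ≺? y) ×-dec (y ≺? v))))))
    where
    _≺?_ : ∀ u v → Dec (entry order u v ≡ true)
    u ≺? v = entry order u v ≟ᵇ true

  fromTables : ∀ {c} order (queues : Table (Fin c) n) → IsLayout order queues → QueueLayout G
  fromTables {c} order queues (≺-irrefl , ≺-trans , ≺-total , queue-sym , noNest) = record
    { _≺_         = _≺_
    ; ≺-isSTO     = isStrictTotalOrderᶜ record
      { isEquivalence = isEquivalence
      ; trans         = λ {u} {v} {w} → ≺-trans u v w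
      ; compare       = compare
      }
    ; #queues     = c
    ; queueOf     = entry queues
    ; queueOf-sym = λ {u} {v} → queue-sym u v
    ; isQueue     = λ
      { _ {u} {v} {x} {y} (uv , uv∈) (xy , xy∈) (inj₁ nest) →
          noNest u v x y uv xy (trans uv∈ (sym xy∈)) nest
      ; _ {u} {v} {x} {y} (uv , uv∈) (xy , xy∈) (inj₂ nest) →
          noNest x y u v xy uv (trans xy∈ (sym uv∈)) nest }
    }
    where
    _≺_ : Fin n → Fin n → Set
    u ≺ v = entry order u v ≡ true
    ≺-asym : ∀ u v → u ≺ v → ¬ v ≺ u
    ≺-asym u v u≺v v≺u = ≺-irrefl u (≺-trans u v u u≺v v≺u)
    compare : ∀ u v → Tri (u ≺ v) (u ≡ v) (v ≺ u)
    compare u v with u Fin.≟ v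
    ... | yes refl = tri≈ (≺-irrefl u) refl (≺-irrefl u)
    ... | no  u≢v with ≺-total u v u≢v
    ...   | inj₁ u≺v = tri< u≺v u≢v (≺-asym u v u≺v)
    ...   | inj₂ v≺u = tri> (≺-asym v u v≺u) u≢v v≺u

  IsLocalTable : ℕ → Table Bool n → Table (Fin (n * n)) n → Set
  IsLocalTable m order queues =
    Σ[ valid ∈ IsLayout order queues ] IsLocal m (fromTables order queues valid)

  isLocalTable? : ∀ m order queues → Dec (IsLocalTable m order queues)
  isLocalTable? m order queues with isLayout? order queues
  ... | no ¬valid = no (¬valid ∘ proj₁)
  ... | yes valid =
    -- `queuesAt` is computed from the tables alone, so locality transfers between any two proofs of
    -- validity.
    map′ (valid ,_) proj₂ (all? λ u → ∣ QueueLayout.queuesAt (fromTables order queues valid) u ∣ ≤? m)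

  -- Queues are renamed to positions of representative edges, so n * n names suffice.
  module _ (L : QueueLayout G) where
    open QueueLayout L

    Represents : Fin (n * n) → Fin #queues → Set
    Represents p i = let u , v = remQuot n p in Adj G u v × queueOf u v ≡ i

    represents? : ∀ i → Dec (∃[ p ] Represents p i)
    represents? i = any? λ p → let u , v = remQuot n p in adj? G u v ×-dec (queueOf u v Fin.≟ i)

    -- The default is returned only for a queue without edges; for the queue of an edge the search
    -- succeeds, which makes the name a function of the queue.
    representative : Fin #queues → Fin (n * n) → Fin (n * n)
    representative i default with represents? i
    ... | yes (p , _) = p
    ... | no _        = default

    queueName : Fin n → Fin n → Fin (n * n)
    queueName u v = representative (queueOf u v) (combine u v)

    self-represented : ∀ {u v} → Adj G u v → Represents (combine u v) (queueOf u v)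
    self-represented {u} {v} uv =
      subst (λ (x , y) → Adj G x y × queueOf x y ≡ queueOf u v) (sym (remQuot-combine u v)) (uv , refl)

    representative-correct : ∀ {u v} → Adj G u v → ∀ d → Represents (representative (queueOf u v) d) (queueOf u v)
    representative-correct {u} {v} uv d with represents? (queueOf u v)
    ... | yes (_ , r) = r
    ... | no  ¬r      = contradiction (_ , self-represented uv) ¬r

    representative-default : ∀ {u v} → Adj G u v → ∀ d d′ →
      representative (queueOf u v) d ≡ representative (queueOf u v) d′
    representative-default {u} {v} uv d d′ with represents? (queueOf u v)
    ... | yes _  = refl
    ... | no  ¬r = contradiction (_ , self-represented uv) ¬r

    queueName-cong : ∀ {u v x y} → Adj G u v → queueOf u v ≡ queueOf x y → queueName u v ≡ queueName x y
    queueName-cong {u} {v} {x} {y} uv eq =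
      trans (representative-default uv (combine u v) (combine x y))
        (cong (λ i → representative i (combine x y)) eq)

    decode : Fin (n * n) → Fin #queues
    decode p = let u , v = remQuot n p in queueOf u v

    decode-queueName : ∀ {u v} → Adj G u v → decode (queueName u v) ≡ queueOf u v
    decode-queueName uv = proj₂ (representative-correct uv _)

    orderTable : Table Bool n
    orderTable = table λ u v → does (IsStrictTotalOrder._<?_ ≺-isSTO u v)

    queueTable : Table (Fin (n * n)) n
    queueTable = table queueName

    order⁺ : ∀ {u v} → u ≺ v → entry orderTable u v ≡ true
    order⁺ {u} {v} u≺v = trans (entry∘table _ u v) (dec-true (IsStrictTotalOrder._<?_ ≺-isSTO u v) u≺v)

    order⁻ : ∀ {u v} → entry orderTable u v ≡ true → u ≺ v
    order⁻ {u} {v} eq with IsStrictTotalOrder._<?_ ≺-isSTO u v | trans (sym (entry∘table _ u v)) eq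
    ... | yes u≺v | _ = u≺v
    ... | no  _   | ()

    queue-≡ : ∀ {u v} → entry queueTable u v ≡ queueName u v
    queue-≡ {u} {v} = entry∘table queueName u v

    decode-entry : ∀ {u v} → Adj G u v → decode (entry queueTable u v) ≡ queueOf u v
    decode-entry uv = trans (cong decode queue-≡) (decode-queueName uv)

    entry-cong : ∀ {u v x y} → Adj G u v → queueOf u v ≡ queueOf x y →
      entry queueTable u v ≡ entry queueTable x y
    entry-cong uv eq = trans queue-≡ (trans (queueName-cong uv eq) (sym queue-≡))

    tables-layout : IsLayout orderTable queueTable
    tables-layout =
      (λ u u≺u → irrefl refl (order⁻ u≺u)) ,
      (λ u v w u≺v v≺w → order⁺ (≺-trans (order⁻ u≺v) (order⁻ v≺w))) ,
      total ,
      (λ u v uv → entry-cong uv (queueOf-sym uv)) ,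
      λ u v x y uv xy eq (u≺x , x≺y , y≺v) →
        isQueue _ (uv , refl)
          (xy , trans (sym (decode-entry xy)) (trans (cong decode (sym eq)) (decode-entry uv)))
          (inj₁ (order⁻ u≺x , order⁻ x≺y , order⁻ y≺v))
      where
      open IsStrictTotalOrder ≺-isSTO using (compare; irrefl) renaming (trans to ≺-trans)
      total : ∀ u v → u ≢ v → entry orderTable u v ≡ true ⊎ entry orderTable v u ≡ true
      total u v u≢v with compare u v
      ... | tri< u≺v _ _ = inj₁ (order⁺ u≺v)
      ... | tri≈ _ u≡v _ = contradiction u≡v u≢v
      ... | tri> _ _ v≺u = inj₂ (order⁺ v≺u)

    private
      L′ : QueueLayout G
      L′ = fromTables orderTable queueTable tables-layout

    -- `decode` maps the renamed queues at a vertex injectively into the original queues there, so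
    -- renaming does not raise their number.
    tables-local : ∀ {m} → IsLocal m L → IsLocal m L′
    tables-local L-local u =
      ≤-trans (∣∣-injection (QueueLayout.queuesAt L′ u) (queuesAt u) decode into inj) (L-local u)
      where
      into : ∀ {i} → i ∈ˢ QueueLayout.queuesAt L′ u → decode i ∈ˢ queuesAt u
      into i∈ with v , uv , refl ← ∈-queuesAt⁻ L′ i∈ =
        subst (_∈ˢ queuesAt u) (sym (decode-entry uv)) (∈-queuesAt⁺ L uv)
      inj : ∀ {i i′} → i ∈ˢ QueueLayout.queuesAt L′ u → i′ ∈ˢ QueueLayout.queuesAt L′ u →
        decode i ≡ decode i′ → i ≡ i′
      inj i∈ i′∈ eq with v , uv , refl ← ∈-queuesAt⁻ L′ i∈ | v′ , uv′ , refl ← ∈-queuesAt⁻ L′ i′∈ =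
        entry-cong uv (trans (sym (decode-entry uv)) (trans eq (decode-entry uv′)))

  hasLocalLayout? : ∀ m → Dec (HasLocalLayout G m)
  hasLocalLayout? m = map′
    (λ { (order , queues , valid , loc) → fromTables order queues valid , loc })
    (λ { (L , loc) → orderTable L , queueTable L , tables-layout L , tables-local L loc })
    (search-Table search-Bool n λ order → search-Table any? n λ queues → isLocalTable? m order queues)

  -- Each edge joins the star of its smaller endpoint, and nested edges differ in that endpoint. The
  -- resulting `n` queues give the search for the least value its starting point.
  starLayout : QueueLayout G
  starLayout = record
    { _≺_         = _<ᶠ_
    ; ≺-isSTO     = Fin.<-isStrictTotalOrder
    ; #queues     = n
    ; queueOf     = first
    ; queueOf-sym = first-sym
    ; isQueue     = λ
      { i {u} {v} {x} {y} (uv , uv∈) (xy , xy∈) (inj₁ (u<x , x<y , y<v)) →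
          stars-apart u<x x<y y<v (trans uv∈ (sym xy∈))
      ; i {u} {v} {x} {y} (uv , uv∈) (xy , xy∈) (inj₂ (x<u , u<v , v<y)) →
          stars-apart x<u u<v v<y (trans xy∈ (sym uv∈)) }
    }
    where
    first : Fin n → Fin n → Fin n
    first u v with u Fin.<? v
    ... | yes _ = u
    ... | no  _ = v

    first-≡ : ∀ {u v} → u <ᶠ v → first u v ≡ u
    first-≡ {u} {v} u<v with u Fin.<? v
    ... | yes _  = refl
    ... | no u≮v = contradiction u<v u≮v

    first-sym : ∀ {u v} → Adj G u v → first u v ≡ first v u
    first-sym {u} {v} uv with u Fin.<? v | v Fin.<? u
    ... | yes u<v | yes v<u = contradiction v<u (Fin.<-asym u<v)
    ... | yes _   | no _    = refl
    ... | no _    | yes _   = refl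
    ... | no u≮v  | no v≮u with Fin.<-cmp u v
    ...   | tri< u<v _ _ = contradiction u<v u≮v
    ...   | tri≈ _ u≡v _ = sym u≡v
    ...   | tri> _ _ v<u = contradiction v<u v≮u

    stars-apart : ∀ {u v x y} → u <ᶠ x → x <ᶠ y → y <ᶠ v → first u v ≢ first x y
    stars-apart u<x x<y y<v eq =
      Fin.<-irrefl (trans (sym (first-≡ (Fin.<-trans u<x (Fin.<-trans x<y y<v)))) (trans eq (first-≡ x<y))) u<x

  localQueueNumber : ∃[ q ] IsLocalQueueNumber G q
  localQueueNumber = least hasLocalLayout? n (starLayout , λ u → ∣p∣≤n (QueueLayout.queuesAt starLayout u))

lemma10 : ∀ (k ℓ : ℕ) → 1 < k → ℓ ≤ k →
    (∀ (s : ℕ) → 0 < s →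
    ∃[ n ] Σ[ T ∈ KTree k n ]
    (∀ (L : QueueLayout (graph T)) → IsLocal ℓ L →
    ManyNonNestingChildren T L s)) →
    ∃[ n ] Σ[ T ∈ KTree k n ] ∃[ q ]
    (IsLocalQueueNumber (graph T) q × ℓ + 1 ≤ q)
lemma10 k ℓ 1<k ℓ≤k forced =
  let n , T , nonlocal = non-local-tree k ℓ 1<k ℓ≤k forced
      q , number@((L , L-local) , _) = localQueueNumber (graph T)
  in n , T , q , number , ≤-trans (≤-reflexive (+-comm ℓ 1))
       -- If `q` were at most `ℓ`, the layout attaining `q` would be `ℓ`-local.
       (≰⇒> λ q≤ℓ → nonlocal L λ u → ≤-trans (L-local u) q≤ℓ)
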